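{- For every complete lattice $L$, $$\dim_{\nabla}(L)=\min\{\mathrm{cov}(A): A\text{ is meet-dense in } L\}.$$
   Context: A subset $A$ of a complete lattice $L$ is meet-dense if every element of $L$ is the meet (possibly infinite) of a subset of $A$. The complete join-dimension $\dim_\nabla(L)$ is the least cardinal $\kappa$ such that there is a one-to-one map from $L$ into a direct product of $\kappa$ complete chains preserving arbitrary joins. The chain-covering number $\mathrm{cov}(P)$ of a poset $P$ is the least cardinal $\kappa$ such that $P$ is a union of $\kappa$ chains. -}

module Defs where

open import Axiom.ExcludedMiddle using (ExcludedMiddle)
open import Axiom.Extensionality.Propositional using (Extensionality)
open import Data.Product.Base using (Σ; ∃-syntax; _×_; _,_; proj₁)
open import Function.Base using (_∘_)
open import Function.Bundles using (Injection; _↣_)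
open import Level using (Level; Setω; suc; _⊔_)
open import Relation.Binary.Bundles using (Poset)
open import Relation.Binary.Definitions using (Total)
import Relation.Binary.Construct.On as On
open import Relation.Unary using (Pred; _∈_; _⊆_; ⋃; Universal)
open import Data.Sum.Base using (_⊎_)

private
  variable
    ℓ : Level

-- The ambient set theory of the subject is classical.  Excluded middle for
-- arbitrary types (not only propositions) also yields choice of witnesses;
-- together with function extensionality this gives the well-ordering of
-- cardinals that "the least cardinal such that" presupposes.

record Classical : Setω where
  field
    excludedMiddle : ∀ {a} → ExcludedMiddle a
    extensionality : ∀ {a b} → Extensionality a b

-- A cardinal is represented by a set of that cardinality, and κ ≤ μ is the
-- existence of an injection κ ↣ μ.  `IsLeastCardinal K κ` therefore
-- determines κ up to bijection.

IsLeastCardinal : ∀ {p} → (Set ℓ → Set p) → Set ℓ → Set (suc ℓ ⊔ p)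
IsLeastCardinal K κ = K κ × (∀ μ → K μ → κ ↣ μ)

-- Here and below, subsets are predicates; they are not required to respect
-- _≈_, since no notion depends on which representatives belong to a subset.

module _ (P : Poset ℓ ℓ ℓ) where
  open Poset P

  IsSup : Pred Carrier ℓ → Carrier → Set ℓ
  IsSup S s = (∀ x → x ∈ S → x ≤ s) × (∀ u → (∀ x → x ∈ S → x ≤ u) → s ≤ u)

  IsInf : Pred Carrier ℓ → Carrier → Set ℓ
  IsInf S s = (∀ x → x ∈ S → s ≤ x) × (∀ l → (∀ x → x ∈ S → l ≤ x) → l ≤ s)

  IsChain : Pred Carrier ℓ → Set ℓ
  IsChain C = ∀ x y → x ∈ C → y ∈ C → x ≤ y ⊎ y ≤ x

  IsUnionOfChains : Set ℓ → Set (suc ℓ)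
  IsUnionOfChains κ =
    Σ (κ → Pred Carrier ℓ) λ C → (∀ k → IsChain (C k)) × Universal (⋃ κ C)

  IsChainCoveringNumber : Set ℓ → Set (suc ℓ)
  IsChainCoveringNumber = IsLeastCardinal IsUnionOfChains

  subposet : Pred Carrier ℓ → Poset ℓ ℓ ℓ
  subposet A = On.poset P (proj₁ {B = A})

record CompleteLattice ℓ : Set (suc ℓ) where
  field
    poset : Poset ℓ ℓ ℓ
  open Poset poset public
  field
    ⋁     : Pred Carrier ℓ → Carrier
    ⋀     : Pred Carrier ℓ → Carrier
    ⋁-sup : ∀ S → IsSup poset S (⋁ S)
    ⋀-inf : ∀ S → IsInf poset S (⋀ S)

  open Eq public using (setoid)

record CompleteChain ℓ : Set (suc ℓ) where
  field
    completeLattice : CompleteLattice ℓ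
  open CompleteLattice completeLattice public
  field
    total : Total _≤_

module _ {κ : Set ℓ} (C : κ → CompleteChain ℓ) where
  private
    module C k = CompleteChain (C k)

    ΠCarrier : Set ℓ
    ΠCarrier = ∀ k → C.Carrier k

    project : Pred ΠCarrier ℓ → ∀ k → Pred (C.Carrier k) ℓ
    project S k c = ∃[ g ] g ∈ S × C._≈_ k (g k) c

  productPoset : Poset ℓ ℓ ℓ
  productPoset = record
    { Carrier = ΠCarrier
    ; _≈_ = λ f g → ∀ k → C._≈_ k (f k) (g k)
    ; _≤_ = λ f g → ∀ k → C._≤_ k (f k) (g k)
    ; isPartialOrder = record
      { isPreorder = record
        { isEquivalence = record
          { refl = λ k → C.Eq.refl k
          ; sym = λ p k → C.Eq.sym k (p k)
          ; trans = λ p q k → C.Eq.trans k (p k) (q k)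
          }
        ; reflexive = λ p k → C.reflexive k (p k)
        ; trans = λ p q k → C.trans k (p k) (q k)
        }
      ; antisym = λ p q k → C.antisym k (p k) (q k)
      }
    }

  product : CompleteLattice ℓ
  product = record
    { poset = productPoset
    ; ⋁ = λ S k → C.⋁ k (project S k)
    ; ⋀ = λ S k → C.⋀ k (project S k)
    ; ⋁-sup = λ S →
        (λ f f∈S k → let (ub , _) = C.⋁-sup k (project S k) in
          ub (f k) (f , f∈S , C.Eq.refl k))
      , (λ u u-ub k → let (_ , least) = C.⋁-sup k (project S k) in
          least (u k) λ { c (g , g∈S , gk≈c) →
            C.trans k (C.reflexive k (C.Eq.sym k gk≈c)) (u-ub g g∈S k) })
    ; ⋀-inf = λ S →
        (λ f f∈S k → let (lb , _) = C.⋀-inf k (project S k) in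
          lb (f k) (f , f∈S , C.Eq.refl k))
      , (λ l l-lb k → let (_ , greatest) = C.⋀-inf k (project S k) in
          greatest (l k) λ { c (g , g∈S , gk≈c) →
            C.trans k (l-lb g g∈S k) (C.reflexive k gk≈c) })
    }

module _ (L M : CompleteLattice ℓ) where
  private
    module L = CompleteLattice L
    module M = CompleteLattice M

  image : (L.Carrier → M.Carrier) → Pred L.Carrier ℓ → Pred M.Carrier ℓ
  image f S y = ∃[ x ] x ∈ S × f x M.≈ y

  PreservesJoins : (L.Carrier → M.Carrier) → Set (suc ℓ)
  PreservesJoins f = ∀ S → f (L.⋁ S) M.≈ M.⋁ (image f S)

  JoinEmbedding : Set (suc ℓ)
  JoinEmbedding = Σ (Injection L.setoid M.setoid) (PreservesJoins ∘ Injection.to)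

module _ (L : CompleteLattice ℓ) where
  open CompleteLattice L

  EmbedsInProductOfChains : Set ℓ → Set (suc ℓ)
  EmbedsInProductOfChains κ =
    Σ (κ → CompleteChain ℓ) λ C → JoinEmbedding L (product C)

  IsCompleteJoinDimension : Set ℓ → Set (suc ℓ)
  IsCompleteJoinDimension = IsLeastCardinal EmbedsInProductOfChains

  MeetDense : Pred Carrier ℓ → Set (suc ℓ)
  MeetDense A = ∀ x → ∃[ S ] S ⊆ A × IsInf poset S x

  IsCovOfMeetDense : Set ℓ → Set (suc ℓ)
  IsCovOfMeetDense κ =
    ∃[ A ] MeetDense A × IsChainCoveringNumber (subposet poset A) κ

  IsMinCovOfMeetDense : Set ℓ → Set (suc ℓ)
  IsMinCovOfMeetDense = IsLeastCardinal IsCovOfMeetDense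

{-# OPTIONS --safe #-}
module Submission where

open import Defs
open import Data.Bool.Base using (Bool; T)
open import Data.Bool.Properties using (⇔→≡; T-≡)
open import Data.Product.Base using (_×_; ∃; ∃-syntax; _,_; proj₁; proj₂)
open import Data.Sum.Base using (_⊎_; inj₁; inj₂; [_,_]′)
open import Data.Unit.Polymorphic.Base using (⊤)
open import Function.Base using (_∘_; id)
open import Function.Bundles using (_⇔_; mk⇔; Equivalence; Injection; _↣_; mk↣)
open import Function.Construct.Composition using (_↣-∘_; _⇔-∘_)
open import Function.Construct.Symmetry using (⇔-sym)
open import Level using (Level; _⊔_; suc)
open import Relation.Binary.Bundles using (Poset)
open import Relation.Binary.PropositionalEquality
  using (_≡_; _≢_; refl; sym; trans; cong; subst)
open import Relation.Nullary.Decidable.Core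
  using (Dec; yes; no; isYes; toWitness; fromWitness; decidable-stable)
open import Relation.Nullary.Negation.Core using (¬_; contradiction)
open import Relation.Unary using (Pred)

-- Meet-dense sets covered by κ chains and join-embeddings into products of κ
-- complete chains are interconvertible.  A chain C of a meet-dense set preorders
-- L by "every c ∈ C above y is above x"; this is a complete chain, and the
-- identity of L is join-preserving into it.  Conversely a join-embedding
-- f : L → ∏ C_k has coordinates f_k with right adjoints g_k, the range of g_k is
-- a chain, and x = ⋀_k g_k (f_k x).  Least cardinals exist by Hönig's argument:
-- in a maximal set of choice functions of a family (X_i) on which all
-- projections are injective, some projection onto X_i must be surjective, and
-- then X_i injects into every X_j.

private
  variable
    a b i x ℓ p q : Level

-- Boolean-valued subsets keep the power set in the universe of X, which makes
-- the union of all members of a tower available without impredicativity.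
Subset : Set a → Set a
Subset X = X → Bool

infix 4 _∈_ _⊆_

_∈_ : {X : Set a} → X → Subset X → Set
x ∈ P = T (P x)

_⊆_ : {X : Set a} → Subset X → Subset X → Set a
P ⊆ Q = ∀ {x} → x ∈ P → x ∈ Q

-- Classical reasoning and Boolean-valued subsets.

module _ (classical : Classical) where
  open Classical classical

  stable : {A : Set a} → ¬ ¬ A → A
  stable = decidable-stable excludedMiddle

  ¬∀⇒∃¬ : {A : Set a} {B : A → Set b} → ¬ (∀ x → B x) → ∃[ x ] ¬ B x
  ¬∀⇒∃¬ ¬all = stable λ ¬∃ → ¬all λ x → stable λ ¬b → ¬∃ (x , ¬b)

  comprehension : {X : Set a} → Pred X p → Subset X
  comprehension P x = isYes (excludedMiddle {P = P x})

  ∈-comprehension⁻ : {X : Set a} (P : Pred X p) {x : X} → x ∈ comprehension P → P x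
  ∈-comprehension⁻ P = toWitness {a? = excludedMiddle}

  ∈-comprehension⁺ : {X : Set a} (P : Pred X p) {x : X} → P x → x ∈ comprehension P
  ∈-comprehension⁺ P = fromWitness {a? = excludedMiddle}

  ⊆-antisym : {X : Set a} {P Q : Subset X} → P ⊆ Q → Q ⊆ P → P ≡ Q
  ⊆-antisym P⊆Q Q⊆P = extensionality λ x →
    ⇔→≡ (T-≡ ⇔-∘ (mk⇔ P⊆Q Q⊆P ⇔-∘ ⇔-sym T-≡))

  InFamily : {X : Set a} → Subset (Subset X) → Pred X a
  InFamily F x = ∃[ P ] P ∈ F × x ∈ P

  ⋃ˢ : {X : Set a} → Subset (Subset X) → Subset X
  ⋃ˢ F = comprehension (InFamily F)

  -- Towers of subsets and their fixpoints.

  module _ {X : Set a} (step : Subset X → Subset X) where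

    data Tower : Subset X → Set a where
      step-closed : ∀ {P} → Tower P → Tower (step P)
      ⋃-closed    : ∀ F → (∀ P → P ∈ F → Tower P) → Tower (⋃ˢ F)

    module _ (inflationary : ∀ P → P ⊆ step P) where

      -- The one-sided `step P ⊆ Q` strengthens totality enough for an induction on both towers; the
      -- step case calls itself with the two swapped.
      compare : ∀ {P Q} → Tower P → Tower Q → step P ⊆ Q ⊎ Q ⊆ P
      compare tP (step-closed {Q} tQ) with compare tP tQ
      ... | inj₁ sP⊆Q = inj₁ (inflationary Q ∘ sP⊆Q)
      ... | inj₂ Q⊆P with compare tQ tP
      ...   | inj₁ sQ⊆P = inj₂ sQ⊆P
      ...   | inj₂ P⊆Q  =
        -- `step` is not assumed monotone, so the two inclusions are first turned into an equality.
        inj₁ (λ {x} → subst (λ R → x ∈ step R) (⊆-antisym P⊆Q Q⊆P))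
      compare {P} tP (⋃-closed F tF)
        with excludedMiddle {P = ∃[ Q ] Q ∈ F × step P ⊆ Q}
      ... | yes (Q , Q∈F , sP⊆Q) =
        inj₁ λ x∈sP → ∈-comprehension⁺ (InFamily F) (Q , Q∈F , sP⊆Q x∈sP)
      ... | no none = inj₂ λ x∈⋃ →
        let (Q , Q∈F , x∈Q) = ∈-comprehension⁻ (InFamily F) x∈⋃ in
        member Q Q∈F x∈Q
        where
        member : ∀ Q → Q ∈ F → Q ⊆ P
        member Q Q∈F with compare tP (tF Q Q∈F)
        ... | inj₁ sP⊆Q = contradiction (Q , Q∈F , λ {x} → sP⊆Q {x}) none
        ... | inj₂ Q⊆P  = Q⊆P

      Tower-total : ∀ {P Q} → Tower P → Tower Q → P ⊆ Q ⊎ Q ⊆ P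
      Tower-total {P} tP tQ with compare tP tQ
      ... | inj₁ sP⊆Q = inj₁ (sP⊆Q ∘ inflationary P)
      ... | inj₂ Q⊆P  = inj₂ Q⊆P

    -- The union of all tower members is itself a member; hence so is its step, which the union
    -- therefore contains.
    Tower-fixpoint : ∃[ M ] Tower M × step M ⊆ M
    Tower-fixpoint = ⋃ˢ all , top , λ x∈sM →
      ∈-comprehension⁺ (InFamily all)
        (_ , ∈-comprehension⁺ Tower (step-closed top) , x∈sM)
      where
      all = comprehension Tower
      top = ⋃-closed all λ P → ∈-comprehension⁻ Tower

  -- Choice functions and least cardinals.

  module _ {I : Set i} (X : I → Set x) where
    private
      Choices = ∀ i → X i

    Fresh : Subset Choices → Pred Choices (i ⊔ x)
    Fresh P f = ∀ g → g ∈ P → ∀ i → f i ≢ g i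

    ProjectionsInjective : Subset Choices → Set (i ⊔ x)
    ProjectionsInjective P = ∀ f g → f ∈ P → g ∈ P → ∀ i → f i ≡ g i → f ≡ g

    Adjoined : Subset Choices → Choices → Pred Choices (i ⊔ x)
    Adjoined P f g = g ∈ P ⊎ g ≡ f

    -- The decision is an argument so that proofs can split on it; `step` supplies it by excluded
    -- middle.
    adjoin : (P : Subset Choices) → Dec (∃ (Fresh P)) → Subset Choices
    adjoin P (yes (f , _)) = comprehension (Adjoined P f)
    adjoin P (no _)        = P

    ⊆-adjoin : ∀ P d → P ⊆ adjoin P d
    ⊆-adjoin P (yes (f , _)) = ∈-comprehension⁺ (Adjoined P f) ∘ inj₁
    ⊆-adjoin P (no _)        = id

    adjoin-injective : ∀ P d → ProjectionsInjective P → ProjectionsInjective (adjoin P d)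
    adjoin-injective P (no _)            inj = inj
    adjoin-injective P (yes (h , fresh)) inj f g f∈ g∈ i fi≡gi
      with ∈-comprehension⁻ (Adjoined P h) f∈ | ∈-comprehension⁻ (Adjoined P h) g∈
    ... | inj₁ f∈P  | inj₁ g∈P  = inj f g f∈P g∈P i fi≡gi
    ... | inj₁ f∈P  | inj₂ refl = contradiction (sym fi≡gi) (fresh f f∈P i)
    ... | inj₂ refl | inj₁ g∈P  = contradiction fi≡gi (fresh g g∈P i)
    ... | inj₂ refl | inj₂ refl = refl

    -- A fresh `f` that already lies in `P` would differ from itself at `i`.
    adjoin-closed⇒no-fresh : I → ∀ P d → adjoin P d ⊆ P → ¬ ∃ (Fresh P)
    adjoin-closed⇒no-fresh i P (yes (f , fresh)) closed _ =
      fresh f (closed (∈-comprehension⁺ (Adjoined P f) (inj₂ refl))) i refl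
    adjoin-closed⇒no-fresh i P (no none) _ = none

    step : Subset Choices → Subset Choices
    step P = adjoin P excludedMiddle

    Tower-injective : ∀ {P} → Tower step P → ProjectionsInjective P
    Tower-injective (step-closed tP) =
      adjoin-injective _ excludedMiddle (Tower-injective tP)
    Tower-injective (⋃-closed F tF) f g f∈ g∈
      with ∈-comprehension⁻ (InFamily F) f∈ | ∈-comprehension⁻ (InFamily F) g∈
    ... | P , P∈F , f∈P | Q , Q∈F , g∈Q
      -- Totality of the tower puts both functions into the larger of the two sets.
      with Tower-total step (λ P → ⊆-adjoin P excludedMiddle) (tF P P∈F) (tF Q Q∈F)
    ... | inj₁ P⊆Q = Tower-injective (tF Q Q∈F) f g (P⊆Q f∈P) g∈Q
    ... | inj₂ Q⊆P = Tower-injective (tF P P∈F) f g f∈P (Q⊆P g∈Q)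

    least-member : I → ∃[ i ] (∀ j → X i ↣ X j)
    least-member i₀ with Tower-fixpoint step
    ... | M , tM , closed = i* , λ j → mk↣ {to = λ v → lift v j} λ {v} {w} eq →
      -- Lifts that agree at `j` are one function, whose value at `i*` is both `v` and `w`.
      let lifts-equal = Tower-injective tM _ _ (lift∈M v) (lift∈M w) j eq in
      trans (sym (lift-section v)) (trans (cong (λ f → f i*) lifts-equal) (lift-section w))
      where
      Onto : Pred I _
      Onto i = ∀ v → ∃[ f ] f ∈ M × f i ≡ v

      onto : ∃ Onto
      onto = stable λ none →
        -- Values missed by `M`, one in each coordinate, form a fresh choice function.
        let missed = λ i → ¬∀⇒∃¬ (λ all → none (i , all)) in
        adjoin-closed⇒no-fresh i₀ M excludedMiddle closed
          ( (λ i → proj₁ (missed i))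
          , λ g g∈M i eq → proj₂ (missed i) (g , g∈M , sym eq) )

      i* = proj₁ onto

      lift : X i* → Choices
      lift v = proj₁ (proj₂ onto v)

      lift∈M : ∀ v → lift v ∈ M
      lift∈M v = proj₁ (proj₂ (proj₂ onto v))

      lift-section : ∀ v → lift v i* ≡ v
      lift-section v = proj₂ (proj₂ (proj₂ onto v))

  leastCardinal : (K : Set ℓ → Set p) → ∃ K → ∃ (IsLeastCardinal K)
  leastCardinal K inhabited =
    let ((κ , Kκ) , least) = least-member {I = ∃ K} proj₁ inhabited in
    κ , Kκ , λ μ Kμ → least (μ , Kμ)

IsLeastCardinal-cong : {K : Set ℓ → Set p} {J : Set ℓ → Set q} →
  (∀ κ → K κ ⇔ J κ) → ∀ κ → IsLeastCardinal K κ ⇔ IsLeastCardinal J κ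
IsLeastCardinal-cong K⇔J κ = mk⇔
  (λ (Kκ , least) → to (K⇔J κ) Kκ , λ μ Jμ → least μ (from (K⇔J μ) Jμ))
  (λ (Jκ , least) → from (K⇔J κ) Jκ , λ μ Kμ → least μ (to (K⇔J μ) Kμ))
  where open Equivalence

-- Chain covers of meet-dense sets, and the embeddings they give.

module _ (L : CompleteLattice ℓ) where
  open CompleteLattice L renaming (refl to ≤-refl; trans to ≤-trans)

  -- Unlike in `IsCovOfMeetDense`, `κ` may exceed the covering number of `A`; this looser notion is
  -- the one that matches embeddings.
  IsUnionOfChainsMeetDense : Set ℓ → Set (suc ℓ)
  IsUnionOfChainsMeetDense κ =
    ∃[ A ] MeetDense L A × IsUnionOfChains (subposet poset A) κ

  leastCoverings : Classical → ∀ κ →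
    IsLeastCardinal IsUnionOfChainsMeetDense κ ⇔ IsMinCovOfMeetDense L κ
  leastCoverings classical κ = mk⇔
    (λ ((A , dense , cover) , least) →
      (A , dense , cover , λ μ cover′ → least μ (A , dense , cover′))
      , λ { μ (B , dense′ , cover′ , _) → least μ (B , dense′ , cover′) })
    (λ ((A , dense , cover , _) , least) →
      (A , dense , cover)
      , λ { μ (B , dense′ , cover′) →
          -- `μ` may exceed the covering number `ν` of `B`, so the injection from `κ` to `μ` passes
          -- through `ν`.
          let (ν , ν-least) = leastCardinal classical
                (IsUnionOfChains (subposet poset B)) (μ , cover′)
          in proj₂ ν-least μ cover′ ↣-∘ least ν (B , dense′ , ν-least) })

  -- A first candidate, from which the existence of a least cardinal follows.
  union-of-singletons : IsUnionOfChainsMeetDense Carrier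
  union-of-singletons =
    (λ _ → ⊤)
    , (λ v → (λ w → v ≡ w) , _ , (λ { _ refl → ≤-refl }) , λ l below → below v refl)
    , (λ v w → v ≡ proj₁ w)
    , (λ { k _ _ refl refl → inj₁ (≤-refl) })
    , λ (v , _) → v , refl

  module ChainQuotient (classical : Classical) (C : Pred Carrier ℓ) (chain : IsChain poset C) where
    open Classical classical

    infix 4 _≲_

    _≲_ : Carrier → Carrier → Set ℓ
    v ≲ w = ∀ c → C c → w ≤ c → v ≤ c

    ≤⇒≲ : ∀ {v w} → v ≤ w → v ≲ w
    ≤⇒≲ v≤w c _ = ≤-trans v≤w

    ≲-trans : ∀ {u v w} → u ≲ v → v ≲ w → u ≲ w
    ≲-trans u≲v v≲w c c∈C = u≲v c c∈C ∘ v≲w c c∈C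

    -- The members of `C` above a given element form an up-closed part of a chain, and such parts
    -- are nested.
    ≲-total : ∀ v w → v ≲ w ⊎ w ≲ v
    ≲-total v w with excludedMiddle {P = v ≲ w}
    ... | yes v≲w = inj₁ v≲w
    ... | no  v⋦w = inj₂ λ d d∈C v≤d → stable classical λ w≰d →
      v⋦w λ c c∈C w≤c →
        [ ≤-trans v≤d
        , (λ c≤d → contradiction (≤-trans w≤c c≤d) w≰d)
        ]′ (chain d c d∈C c∈C)

    -- The quotient only coarsens equality and keeps the carrier.
    ≲-poset : Poset ℓ ℓ ℓ
    ≲-poset = record
      { Carrier = Carrier
      ; _≈_ = λ v w → v ≲ w × w ≲ v
      ; _≤_ = _≲_
      ; isPartialOrder = record
        { isPreorder = record
          { isEquivalence = record
            { refl = (λ _ _ → id) , (λ _ _ → id)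
            ; sym = λ (p , q) → q , p
            ; trans = λ (p , q) (r , s) → ≲-trans p r , ≲-trans s q
            }
          ; reflexive = proj₁
          ; trans = ≲-trans
          }
        ; antisym = _,_
        }
      }

    ⋁-≲-sup : ∀ S → IsSup ≲-poset S (⋁ S)
    ⋁-≲-sup S =
      (λ v v∈S → ≤⇒≲ (proj₁ (⋁-sup S) v v∈S))
      , λ u above c c∈C u≤c → proj₂ (⋁-sup S) c λ v v∈S → above v v∈S c c∈C u≤c

    LowerBound : Pred Carrier ℓ → Pred Carrier ℓ
    LowerBound S l = ∀ v → S v → l ≲ v

    completeChain : CompleteChain ℓ
    completeChain = record
      { completeLattice = record
        { poset = ≲-poset
        ; ⋁ = ⋁
        -- The meet of `L` need not be a greatest lower bound for `≲`.
        ; ⋀ = ⋁ ∘ LowerBound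
        ; ⋁-sup = ⋁-≲-sup
        ; ⋀-inf = λ S →
            (λ v v∈S → proj₂ (⋁-≲-sup (LowerBound S)) v λ l below → below v v∈S)
            , λ l below → proj₁ (⋁-≲-sup (LowerBound S)) l below
        }
      ; total = ≲-total
      }

  cover⇒embedding : Classical → ∀ {κ} →
    IsUnionOfChainsMeetDense κ → EmbedsInProductOfChains L κ
  cover⇒embedding classical {κ} (A , dense , C , chain , covers) =
    D.completeChain , injection , preserves
    where
    members : κ → Pred Carrier ℓ
    members k v = ∃[ v∈A ] C k (v , v∈A)

    module D (k : κ) = ChainQuotient classical (members k)
      (λ v w (v∈A , v∈C) (w∈A , w∈C) → chain k (v , v∈A) (w , w∈A) v∈C w∈C)
    open D using (_≲_; ≤⇒≲)
    module Π = CompleteLattice (product D.completeChain)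

    -- `w` is a meet of elements `s` of `A`, and the chain containing `s` forces `v ≤ s`.
    reflects : ∀ {v w} → (∀ k → (k ≲ v) w) → v ≤ w
    reflects {v} {w} v≲w =
      let (S , S⊆A , below , greatest) = dense w in
      greatest v λ s s∈S →
        let (k , s∈C) = covers (s , S⊆A s∈S) in
        v≲w k s (S⊆A s∈S , s∈C) (below s s∈S)

    injection : Injection setoid Π.setoid
    injection = record
      { to = λ v _ → v
      ; cong = λ v≈w k → ≤⇒≲ k (reflexive v≈w) , ≤⇒≲ k (reflexive (Eq.sym v≈w))
      ; injective = λ v≈w → antisym (reflects (proj₁ ∘ v≈w)) (reflects (proj₂ ∘ v≈w))
      }

    -- The product joins everything equivalent to a member of `S`, so the two joins are compared as
    -- suprema.
    preserves : PreservesJoins L (product D.completeChain) (Injection.to injection)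
    preserves S k =
      proj₂ (D.⋁-≲-sup k S) _ (λ v v∈S →
        proj₁ (D.⋁-≲-sup k _) v ((λ _ → v) , (v , v∈S , same v) , same v k))
      , proj₂ (D.⋁-≲-sup k _) (⋁ S) λ { _ (_ , (v , v∈S , v≈g) , g≈c) →
          D.≲-trans k (proj₂ g≈c)
            (D.≲-trans k (proj₂ (v≈g k)) (≤⇒≲ k (proj₁ (⋁-sup S) v v∈S))) }
      where
      same : ∀ v → (λ _ → v) Π.≈ (λ _ → v)
      same v = Injection.cong injection (Eq.refl {v})

-- Join-embeddings and order.

module _ (L M : CompleteLattice ℓ) (embedding : JoinEmbedding L M) where
  private
    module L = CompleteLattice L
    module M = CompleteLattice M
    open Injection (proj₁ embedding) using (to; injective) renaming (cong to to-cong)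
    preserves = proj₂ embedding

  joinEmbedding-⋁ : ∀ S → IsSup M.poset (image L M to S) (to (L.⋁ S))
  joinEmbedding-⋁ S =
    let (above , least) = M.⋁-sup (image L M to S) in
    (λ y y∈ → M.trans (above y y∈) (M.reflexive (M.Eq.sym (preserves S))))
    , λ u u-above → M.trans (M.reflexive (preserves S)) (least u u-above)

  joinEmbedding-mono : ∀ {v w} → v L.≤ w → to v M.≤ to w
  joinEmbedding-mono {v} {w} v≤w =
    M.trans
      (proj₁ (joinEmbedding-⋁ below-w) (to v) (v , v≤w , M.Eq.refl))
      (M.reflexive (to-cong (L.antisym
        (proj₂ (L.⋁-sup below-w) w λ _ → id)
        (proj₁ (L.⋁-sup below-w) w L.refl))))
    where below-w = λ u → u L.≤ w

  -- The join of `v` and `w` has the same image as `w`, so injectivity identifies the two.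
  joinEmbedding-reflects : ∀ {v w} → to v M.≤ to w → v L.≤ w
  joinEmbedding-reflects {v} {w} fv≤fw =
    L.trans (above v (inj₁ refl)) (L.reflexive (injective (M.antisym
      (proj₂ (joinEmbedding-⋁ pair) (to w) λ
        { y (_ , inj₁ refl , fv≈y) → M.trans (M.reflexive (M.Eq.sym fv≈y)) fv≤fw
        ; y (_ , inj₂ refl , fw≈y) → M.reflexive (M.Eq.sym fw≈y) })
      (joinEmbedding-mono (above w (inj₂ refl))))))
    where
    pair : Pred L.Carrier ℓ
    pair u = u ≡ v ⊎ u ≡ w
    above = proj₁ (L.⋁-sup pair)

-- From embeddings to chain covers.

module _ (L : CompleteLattice ℓ) where
  open CompleteLattice L renaming (refl to ≤-refl; trans to ≤-trans)

  embedding⇒cover : ∀ {κ} → EmbedsInProductOfChains L κ → IsUnionOfChainsMeetDense L κ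
  embedding⇒cover {κ} (C , embedding) =
    A , dense , ranges , ranges-chain , λ (_ , k , c , eq) → k , c , eq
    where
    module C k = CompleteChain (C k)
    f = Injection.to (proj₁ embedding)

    below : ∀ k → C.Carrier k → Pred Carrier ℓ
    below k c v = C._≤_ k (f v k) c

    g : ∀ k → C.Carrier k → Carrier
    g k c = ⋁ (below k c)

    -- Join preservation makes the `k`-th coordinate at `g k c` a join of values below `c`.
    counit : ∀ k c → C._≤_ k (f (g k c) k) c
    counit k c = C.trans k (C.reflexive k (proj₂ embedding (below k c) k))
      (proj₂ (C.⋁-sup k _) c λ { d (h , (v , fv≤c , fv≈h) , hk≈d) →
        C.trans k (C.reflexive k (C.Eq.sym k (C.Eq.trans k (fv≈h k) hk≈d))) fv≤c })

    g-mono : ∀ k {c d} → C._≤_ k c d → g k c ≤ g k d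
    g-mono k {c} {d} c≤d = proj₂ (⋁-sup (below k c)) (g k d) λ v fv≤c →
      proj₁ (⋁-sup (below k d)) v (C.trans k fv≤c c≤d)

    A : Pred Carrier ℓ
    A v = ∃[ k ] ∃[ c ] v ≡ g k c

    dense : MeetDense L A
    dense v = (λ w → ∃[ k ] w ≡ g k (f v k)) , (λ (k , eq) → k , f v k , eq)
      , (λ { _ (k , refl) → proj₁ (⋁-sup (below k (f v k))) v (C.refl k) })
      , λ l l-below → joinEmbedding-reflects L (product C) embedding λ k →
          C.trans k
            (joinEmbedding-mono L (product C) embedding (l-below _ (k , refl)) k)
            (counit k (f v k))

    ranges : κ → Pred (∃ A) ℓ
    ranges k (v , _) = ∃[ c ] v ≡ g k c

    ranges-chain : ∀ k → IsChain (subposet poset A) (ranges k)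
    ranges-chain k (_ , _) (_ , _) (c , refl) (d , refl) =
      [ inj₁ ∘ g-mono k , inj₂ ∘ g-mono k ]′ (C.total k c d)

theorem7p4 : Classical → ∀ {ℓ} (L : CompleteLattice ℓ) →
    ∃ (IsCompleteJoinDimension L) × (∀ κ → IsCompleteJoinDimension L κ ⇔ IsMinCovOfMeetDense L κ)
theorem7p4 classical L =
  leastCardinal classical (EmbedsInProductOfChains L)
    (_ , cover⇒embedding L classical (union-of-singletons L))
  , λ κ → leastCoverings L classical κ ⇔-∘
      IsLeastCardinal-cong (λ μ → mk⇔ (embedding⇒cover L) (cover⇒embedding L classical)) κ
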